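{- Let $A$ be a $J_p$-set in $(\mathbb{N},+)$ and let $B\subseteq\mathbb{N}$ be finite. Then $A\setminus B$ is a $J_p$-set in $(\mathbb{N},+)$.
   Context: $\mathbb{N}=\{1,2,\dots\}$. $\mathbb{P}$ denotes the set of polynomials with coefficients in $\mathbb{N}\cup\{0\}$ and zero constant term which map $\mathbb{N}$ into $\mathbb{N}$. $\mathcal{P}_f(X)$ is the set of nonempty finite subsets of $X$, and ${}^{\mathbb{N}}\mathbb{N}$ the set of sequences in $\mathbb{N}$. For $R\in\mathcal{P}_f(\mathbb{P})$, $L\in\mathcal{P}_f({}^{\mathbb{N}}\mathbb{N})$, $a\in\mathbb{N}$, $H\in\mathcal{P}_f(\mathbb{N})$, $S_{R,L}(a,H)=\{a+f(\sum_{t\in H}g(t)): f\in R, g\in L\}$. $A\subseteq\mathbb{N}$ is a $J_p$-set if for every $R\in\mathcal{P}_f(\mathbb{P})$ and $L\in\mathcal{P}_f({}^{\mathbb{N}}\mathbb{N})$ there exist $a\in\mathbb{N}$ and $H\in\mathcal{P}_f(\mathbb{N})$ with $S_{R,L}(a,H)\subseteq A$. -}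

module Defs where

open import Data.List.Base using (List; []; _∷_)
import Data.List.Membership.Propositional as List
open import Data.List.NonEmpty.Base as List⁺ using (List⁺; foldr₁; toList)
open import Data.List.Relation.Unary.Unique.Propositional using (Unique)
open import Data.Nat.Base using (ℕ; zero; suc; _+_; _*_; NonZero)
open import Data.Product.Base using (∃; ∃-syntax; _×_)
open import Function.Bundles using (_⇔_)
open import Level using (Level)
open import Relation.Binary.PropositionalEquality.Core using (_≡_)
open import Relation.Unary using (Pred; _∈_; _⊆_)

private
  variable
    a : Level
    X : Set a

-- The natural numbers of the mathematics start at 1.  The proof of
-- positivity is irrelevant, so equality in ℕ⁺ is equality of values.
record ℕ⁺ : Set where
  constructor mkℕ⁺
  field
    value       : ℕ
    .{{nonZero}} : NonZero value

open ℕ⁺ public using (value)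

+-nonZero : ∀ m n .{{_ : NonZero m}} → NonZero (m + n)
+-nonZero (suc m) n = _

infixl 6 _+⁺_

_+⁺_ : ℕ⁺ → ℕ⁺ → ℕ⁺
mkℕ⁺ m +⁺ mkℕ⁺ n = mkℕ⁺ (m + n) {{+-nonZero m n}}

-- A list c₀ ∷ c₁ ∷ … ∷ c_d ∷ [] stands for c₀ + c₁ x + … + c_d x^d.
constantTerm : List ℕ → ℕ
constantTerm []      = 0
constantTerm (c ∷ _) = c

eval : List ℕ → ℕ → ℕ
eval []       x = 0
eval (c ∷ cs) x = c + x * eval cs x

-- Trailing zeros are allowed, so one polynomial has several
-- representatives; only the induced function ⟦_⟧ is used below.
record ℙ : Set where
  field
    coefficients   : List ℕ
    constantTerm≡0 : constantTerm coefficients ≡ 0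
    eval-nonZero   : ∀ n .{{_ : NonZero n}} → NonZero (eval coefficients n)

  ⟦_⟧ : ℕ⁺ → ℕ⁺
  ⟦ mkℕ⁺ n ⟧ = mkℕ⁺ (eval coefficients n) {{eval-nonZero n}}

open ℙ public using (⟦_⟧)

-- A nonempty finite subset of X, given by listing its elements.
-- Repetitions are harmless where only membership matters.
𝒫f : Set a → Set a
𝒫f X = List⁺ X

infix 4 _∈f_

_∈f_ : {X : Set a} → X → 𝒫f X → Set a
x ∈f F = x List.∈ toList F

-- Nonempty finite subsets of ℕ⁺ that serve as index sets of sums: each
-- element must be listed exactly once.
record IndexSet : Set where
  field
    elements : 𝒫f ℕ⁺
    distinct : Unique (toList elements)

∑ : IndexSet → (ℕ⁺ → ℕ⁺) → ℕ⁺
∑ H g = foldr₁ _+⁺_ (List⁺.map g (IndexSet.elements H))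

S : 𝒫f ℙ → 𝒫f (ℕ⁺ → ℕ⁺) → ℕ⁺ → IndexSet → Pred ℕ⁺ _
S R L a H x =
  ∃[ f ] ∃[ g ] f ∈f R × g ∈f L × x ≡ a +⁺ ⟦ f ⟧ (∑ H g)

IsJₚ : Pred ℕ⁺ a → Set a
IsJₚ A = ∀ (R : 𝒫f ℙ) (L : 𝒫f (ℕ⁺ → ℕ⁺)) →
  ∃[ a ] ∃[ H ] S R L a H ⊆ A

Finite : Pred X a → Set _
Finite {X = X} B = ∃ λ (xs : List X) → ∀ x → x ∈ B ⇔ x List.∈ xs

{-# OPTIONS --safe #-}

-- A value f(n) of f ∈ ℙ is at least n, since f(n) is a nonzero multiple
-- of n.  Hence it suffices to make every sum ∑_{t∈H} g(t) exceed max B.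
-- With K = 1 + max B, replace each g ∈ L by the sequence whose t-th term is
-- the sum of g over the block [Kt, Kt + K): such a sum is at least K, and a
-- sum of the new sequence over H is a sum of g over a union of disjoint
-- blocks.
module Submission where

open import Defs
open import Algebra.Definitions using (Associative)
open import Data.List.Base using ([]; _∷_; upTo)
import Data.List.Base as List
open import Data.List.Extrema.Nat using (max; xs≤max)
open import Data.List.Membership.Propositional.Properties using (∈-map⁺; ∈-map⁻; ∈-upTo⁻)
open import Data.List.NonEmpty.Base as List⁺
  using (List⁺; _∷_; foldr₁; toList; concatMap; _⁺++⁺_)
import Data.List.NonEmpty.Properties as List⁺
open import Data.List.Properties using (length-upTo; ++-identityʳ)
open import Data.List.Relation.Binary.Disjoint.Propositional using (Disjoint)
import Data.List.Relation.Unary.All as All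
import Data.List.Relation.Unary.All.Properties as All
import Data.List.Relation.Unary.AllPairs as AllPairs
import Data.List.Relation.Unary.AllPairs.Properties as AllPairs
open import Data.List.Relation.Unary.Unique.Propositional using (Unique)
import Data.List.Relation.Unary.Unique.Propositional.Properties as Unique
open import Data.Nat.Base
  using (ℕ; suc; _+_; _*_; _/_; _≤_; _<_; NonZero; z≤n; s≤s)
open import Data.Nat.Divisibility using (n∣m*n)
open import Data.Nat.DivMod using (+-distrib-/-∣ˡ; m*n/n≡m; m<n⇒m/n≡0)
open import Data.Nat.Properties
  using (+-assoc; +-cancelˡ-≡; +-identityʳ; +-mono-≤; <⇒≱; m*n≢0; m*n≢0⇒n≢0;
         m≤m*n; m≤m+n; m≤n+m; ≤-refl; ≤-trans; module ≤-Reasoning)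
open import Data.Product.Base using (_,_)
open import Function.Base using (_∘_)
open import Function.Bundles using (Equivalence)
open import Level using (Level)
open import Relation.Binary.PropositionalEquality
  using (_≡_; _≢_; refl; sym; trans; cong; cong₂; subst; module ≡-Reasoning)
open import Relation.Unary using (Pred; _∖_)

private
  variable
    a : Level
    X Y : Set a

value-injective : ∀ {m n : ℕ⁺} → value m ≡ value n → m ≡ n
value-injective refl = refl

+⁺-assoc : Associative _≡_ _+⁺_
+⁺-assoc l m n = value-injective (+-assoc (value l) (value m) (value n))

1≤value : ∀ n → 1 ≤ value n
1≤value (mkℕ⁺ (suc n)) = s≤s z≤n

n≤⟦f⟧n : ∀ f n → value n ≤ value (⟦ f ⟧ n)
n≤⟦f⟧n f (mkℕ⁺ n) = bound (ℙ.coefficients f) (ℙ.constantTerm≡0 f) (ℙ.eval-nonZero f n)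
  where
  bound : ∀ cs → constantTerm cs ≡ 0 → NonZero (eval cs n) → n ≤ eval cs n
  -- With zero constant term the value is `n * eval cs n`, so its being nonzero makes `eval cs n` at
  -- least 1. The empty list cannot occur, as its value is 0.
  bound (_ ∷ cs) refl nz = m≤m*n n (eval cs n) {{m*n≢0⇒n≢0 n {{nz}}}}

module _ {_∙_ : X → X → X} (assoc : Associative _≡_ _∙_) where

  foldr₁-⁺++⁺ : ∀ xs ys → foldr₁ _∙_ (xs ⁺++⁺ ys) ≡ foldr₁ _∙_ xs ∙ foldr₁ _∙_ ys
  foldr₁-⁺++⁺ (x ∷ xs) ys = go x xs
    where
    go : ∀ x xs → foldr₁ _∙_ ((x ∷ xs) ⁺++⁺ ys) ≡ foldr₁ _∙_ (x ∷ xs) ∙ foldr₁ _∙_ ys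
    go x []        = refl
    go x (x′ ∷ xs) = trans (cong (x ∙_) (go x′ xs)) (sym (assoc x _ _))

  -- Concatenation keeps the order of the terms, so associativity suffices to regroup them. This
  -- turns a sum over a union of blocks into a sum of block sums.
  foldr₁-concatMap : ∀ (g : Y → X) (f : Y → List⁺ Y) ys →
    foldr₁ _∙_ (List⁺.map g (concatMap f ys)) ≡
    foldr₁ _∙_ (List⁺.map (foldr₁ _∙_ ∘ List⁺.map g ∘ f) ys)
  foldr₁-concatMap g f (y ∷ ys) = go y ys
    where
    open ≡-Reasoning

    fold : List⁺ _ → _
    fold = foldr₁ _∙_ ∘ List⁺.map g

    go : ∀ y ys → fold (concatMap f (y ∷ ys)) ≡ foldr₁ _∙_ (List⁺.map (fold ∘ f) (y ∷ ys))
    go y [] = cong (λ zs → fold (List⁺.head (f y) ∷ zs)) (++-identityʳ (List⁺.tail (f y)))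
    go y (y′ ∷ ys) = begin
      fold (f y ⁺++⁺ concatMap f (y′ ∷ ys))
        ≡⟨ cong (foldr₁ _∙_) (List⁺.map-⁺++⁺ g (f y) _) ⟩
      foldr₁ _∙_ (List⁺.map g (f y) ⁺++⁺ List⁺.map g (concatMap f (y′ ∷ ys)))
        ≡⟨ foldr₁-⁺++⁺ (List⁺.map g (f y)) _ ⟩
      fold (f y) ∙ fold (concatMap f (y′ ∷ ys))
        ≡⟨ cong (_ ∙_) (go y′ ys) ⟩
      foldr₁ _∙_ (List⁺.map (fold ∘ f) (y ∷ y′ ∷ ys)) ∎

head≤sum : ∀ xs → value (List⁺.head xs) ≤ value (foldr₁ _+⁺_ xs)
head≤sum (x ∷ [])     = ≤-refl
head≤sum (x ∷ y ∷ ys) = m≤m+n (value x) _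

length≤sum : ∀ xs → List⁺.length xs ≤ value (foldr₁ _+⁺_ xs)
length≤sum (x ∷ xs) = go x xs
  where
  go : ∀ x xs → List⁺.length (x ∷ xs) ≤ value (foldr₁ _+⁺_ (x ∷ xs))
  go x []       = 1≤value x
  go x (y ∷ ys) = +-mono-≤ (1≤value x) (go y ys)

module Blocks (M : ℕ) where

  K : ℕ
  K = suc M

  -- Since `t` is at least 1, `t * K` is already positive, so the offset `i = 0` is allowed.
  entry : ℕ⁺ → ℕ → ℕ⁺
  entry (mkℕ⁺ t) i = mkℕ⁺ (t * K + i) {{+-nonZero (t * K) i {{m*n≢0 t K}}}}

  entry-injective : ∀ t {i j} → entry t i ≡ entry t j → i ≡ j
  entry-injective t eq = +-cancelˡ-≡ (value t * K) _ _ (cong value eq)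

  -- The list of offsets is `upTo K` with its first element split off, which makes nonemptiness
  -- visible.
  block : ℕ⁺ → List⁺ ℕ⁺
  block t = List⁺.map (entry t) (0 ∷ List.applyUpTo suc M)

  length-block : ∀ t → List⁺.length (block t) ≡ K
  length-block t = trans (List⁺.length-map (entry t) (0 ∷ List.applyUpTo suc M)) (length-upTo K)

  block-unique : ∀ t → Unique (toList (block t))
  block-unique t = Unique.map⁺ (entry-injective t) (Unique.upTo⁺ K)

  -- Offsets are below `K`, so division by `K` recovers the index of the block. Hence blocks with
  -- different indices share no element.
  ∈-block⇒quotient : ∀ {x} t → x ∈f block t → value x / K ≡ value t
  ∈-block⇒quotient t x∈ with i , i∈ , refl ← ∈-map⁻ (entry t) {xs = upTo K} x∈ = begin
    (value t * K + i) / K      ≡⟨ +-distrib-/-∣ˡ i (n∣m*n (value t)) ⟩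
    value t * K / K + i / K    ≡⟨ cong₂ _+_ (m*n/n≡m (value t) K) (m<n⇒m/n≡0 (∈-upTo⁻ i∈)) ⟩
    value t + 0                ≡⟨ +-identityʳ _ ⟩
    value t                    ∎
    where open ≡-Reasoning

  blocks-disjoint : ∀ {t u} → t ≢ u → Disjoint (toList (block t)) (toList (block u))
  blocks-disjoint {t} {u} t≢u (x∈t , x∈u) =
    t≢u (value-injective (trans (sym (∈-block⇒quotient t x∈t)) (∈-block⇒quotient u x∈u)))

  expand : IndexSet → IndexSet
  expand H = record
    { elements = concatMap block ts
    -- No repetition occurs inside a block because `entry t` is injective, and none across blocks
    -- because the indices in `H` are distinct.
    ; distinct = subst Unique (List⁺.toList->>= block ts)
        (Unique.concat⁺
          (All.map⁺ (All.universal block-unique (toList ts)))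
          (AllPairs.map⁺ (AllPairs.map blocks-disjoint (IndexSet.distinct H))))
    }
    where ts = IndexSet.elements H

  blockSum : (ℕ⁺ → ℕ⁺) → ℕ⁺ → ℕ⁺
  blockSum g t = foldr₁ _+⁺_ (List⁺.map g (block t))

  ∑-expand : ∀ H g → ∑ (expand H) g ≡ ∑ H (blockSum g)
  ∑-expand H g = foldr₁-concatMap +⁺-assoc g block (IndexSet.elements H)

  K≤blockSum : ∀ g t → K ≤ value (blockSum g t)
  K≤blockSum g t = begin
    K                                       ≡⟨ length-block t ⟨
    List⁺.length (block t)                  ≡⟨ List⁺.length-map g (block t) ⟨
    List⁺.length (List⁺.map g (block t))    ≤⟨ length≤sum (List⁺.map g (block t)) ⟩
    value (blockSum g t)                    ∎
    where open ≤-Reasoning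

  M<∑-expand : ∀ H g → M < value (∑ (expand H) g)
  M<∑-expand H g rewrite ∑-expand H g =
    -- A single block, that of the first index, already contributes `K = suc M`, which gives the
    -- strict bound.
    ≤-trans (K≤blockSum g (List⁺.head (IndexSet.elements H)))
            (head≤sum (List⁺.map (blockSum g) (IndexSet.elements H)))

theorem5p3 : {a b : Level} (A : Pred ℕ⁺ a) (B : Pred ℕ⁺ b) →
    IsJₚ A → Finite B → IsJₚ (A ∖ B)
theorem5p3 A B A-Jₚ (bs , B⇔bs) R L
  with A-Jₚ R (List⁺.map (Blocks.blockSum (max 0 (List.map value bs))) L)
... | c , H , S⊆A = c , expand H , λ where
    -- By `∑-expand`, the point given by `f` and `g` over `expand H` is the point given by `f` and
    -- `blockSum g` over `H`, which lies in `A` by the choice of `c` and `H`.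
    (f , g , f∈R , g∈L , refl) →
      S⊆A (f , blockSum g , f∈R , ∈-map⁺ blockSum g∈L
          , cong (λ s → c +⁺ ⟦ f ⟧ s) (∑-expand H g))
      , λ x∈B → <⇒≱ (large f g) (≤M x∈B)
  where
  M : ℕ
  -- The default 0 covers the case of empty `B`.
  M = max 0 (List.map value bs)

  open Blocks M

  ≤M : ∀ {x} → B x → value x ≤ M
  ≤M {x} x∈B = All.lookup (xs≤max 0 (List.map value bs))
    (∈-map⁺ value (Equivalence.to (B⇔bs x) x∈B))

  large : ∀ f g → M < value (c +⁺ ⟦ f ⟧ (∑ (expand H) g))
  large f g = begin-strict
    M                                          <⟨ M<∑-expand H g ⟩
    value (∑ (expand H) g)                     ≤⟨ n≤⟦f⟧n f (∑ (expand H) g) ⟩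
    value (⟦ f ⟧ (∑ (expand H) g))             ≤⟨ m≤n+m _ (value c) ⟩
    value (c +⁺ ⟦ f ⟧ (∑ (expand H) g))        ∎
    where open ≤-Reasoning
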